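{- Let $k\ge 1$ and let $\beta_1\ge\beta_2\ge\cdots\ge\beta_{k-1}\ge\beta_k$ be a finite non-increasing sequence of integers with $\beta_k\ge k$. Then there exists a graph $G$ with $\nu_{d,i}(G)=\beta_i$ for all $i\in\{1,\dots,k\}$.
   Context: All graphs are finite, simple and undirected (not necessarily connected). For a matching $M$ of $G$, $G[M]$ denotes the subgraph of $G$ induced by the set $V(M)$ of endpoints of edges of $M$. For an integer $c\ge 1$, a matching $M$ is $c$-disconnected if $G[M]$ has at least $c$ connected components; by convention the empty matching is $c$-disconnected for every $c$. $\nu_{d,c}(G)$ is the maximum size of a $c$-disconnected matching of $G$ (so $\nu_{d,1}(G)$ is the matching number). -}

module Defs where

open import Data.Fin using (Fin)
open import Data.Fin.Subset using (Subset; _∈_; Empty; ⁅_⁆; _∪_; _∩_; ⋃)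
open import Data.List using (List; []; length)
open import Data.List.Relation.Unary.All using (All)
open import Data.List.Relation.Unary.AllPairs using (AllPairs)
open import Data.Nat using (ℕ; _≤_)
open import Data.Product using (_×_; ∃; ∃₂)
open import Data.Sum using (_⊎_)
open import Function using (_⇔_)
open import Function.Definitions using (Injective)
open import Level using (0ℓ)
open import Relation.Binary using (Rel; Symmetric; Irreflexive; Decidable)
open import Relation.Binary.Construct.Closure.ReflexiveTransitive using (Star)
open import Relation.Binary.PropositionalEquality using (_≡_)

record Graph : Set₁ where
  field
    order  : ℕ
    Adj    : Rel (Fin order) 0ℓ
    adj?   : Decidable Adj
    sym    : Symmetric Adj
    irrefl : Irreflexive _≡_ Adj

  Vertex : Set
  Vertex = Fin order

  VertexSet : Set
  VertexSet = Subset order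

module _ (G : Graph) where
  open Graph G

  IsEdge : VertexSet → Set
  IsEdge e = ∃₂ λ u v → Adj u v × e ≡ ⁅ u ⁆ ∪ ⁅ v ⁆

  -- A matching is a set of edges, listed in an arbitrary order.  Edges are
  -- nonempty, so pairwise disjointness also rules out repetitions and the
  -- length of the list is the size of the matching.
  record IsMatching (M : List VertexSet) : Set where
    field
      edges    : All IsEdge M
      disjoint : AllPairs (λ e f → Empty (e ∩ f)) M

  -- Adjacency in the induced subgraph G[S], whose vertices are those of S.
  InducedAdj : VertexSet → Rel Vertex 0ℓ
  InducedAdj S u v = u ∈ S × v ∈ S × Adj u v

  -- C is (the vertex set of) a connected component of G[S]: the set of all
  -- vertices that can be reached by a walk in G[S] from some vertex u of G[S].
  IsComponent : VertexSet → VertexSet → Set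
  IsComponent S C =
    ∃ λ u → u ∈ S × (∀ v → v ∈ C ⇔ Star (InducedAdj S) u v)

  HasAtLeastComponents : VertexSet → ℕ → Set
  HasAtLeastComponents S c =
    ∃ λ (C : Fin c → VertexSet) →
      Injective _≡_ _≡_ C × (∀ i → IsComponent S (C i))

  -- ⋃ M is the set V(M) of endpoints of edges of M.
  record IsDisconnectedMatching (c : ℕ) (M : List VertexSet) : Set where
    field
      matching     : IsMatching M
      disconnected : M ≡ [] ⊎ HasAtLeastComponents (⋃ M) c

  -- ν_{d,c}(G) = m
  record DisconnectedMatchingNumber (c m : ℕ) : Set where
    field
      attained : ∃ λ M → IsDisconnectedMatching c M × length M ≡ m
      maximal  : ∀ M → IsDisconnectedMatching c M → length M ≤ m

{-# OPTIONS --safe #-}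

-- Extend β by β_p = k - 1 for p > k (1-based).  Take β_1 disjoint pairs of
-- vertices, ranked 0, 1, 2, …; the two vertices of a pair are adjacent, and
-- pairs p and q are completely joined when β_{p+2} ≤ q or β_{q+2} ≤ p.
-- The pairs of rank below β_i form a matching of size β_i in which each of
-- the pairs 0, …, i-2 is a component, while pair β_i - 1 lies in another one.
-- For i ≥ 2, a larger matching uses some vertex w of rank at least β_i, which is adjacent
-- to all vertices of rank at least i-2 in another pair, so at most i-1
-- components occur: that of w, and those inside the pairs 0, …, i-3.
module Submission where

open import Defs
open import Data.Fin as Fin using (Fin; zero; suc; toℕ; fromℕ; fromℕ<; combine; quotient; remainder)
open import Data.Fin.Properties as Finₚ using (toℕ<n)
open import Data.Fin.Subset using (Subset; inside; outside; _∈_; _⊆_; Empty; ⁅_⁆; _∪_; _∩_; ⋃; ∣_∣)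
open import Data.Fin.Subset.Properties
open import Data.Integer as ℤ using (ℤ; +_)
import Data.Integer.Properties as ℤₚ
open import Data.List as List using (List; []; _∷_; length)
open import Data.List.Properties using (length-tabulate)
open import Data.List.Relation.Unary.All as All using (All; []; _∷_)
import Data.List.Relation.Unary.All.Properties as Allₚ
open import Data.List.Relation.Unary.AllPairs using (AllPairs; []; _∷_)
import Data.List.Relation.Unary.AllPairs.Properties as AllPairsₚ
open import Data.List.Relation.Unary.Any using (Any; here; there)
import Data.List.Relation.Unary.Any.Properties as Anyₚ
open import Data.Nat using (ℕ; zero; suc; _+_; _*_; _⊓_; _≤_; _<_;
  _≟_; _≤?_; _<?_; pred; >-nonZero; z≤n; s≤s)
open import Data.Nat.Properties
open import Data.Product using (_×_; _,_; ∃; ∃₂; proj₁; proj₂)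
open import Data.Sum using (_⊎_; inj₁; inj₂)
open import Data.Vec as Vec using ([]; _∷_; here; there)
open import Data.Vec.Properties using (lookup⇒[]=; []=⇒lookup; lookup∘tabulate)
open import Function using (mk⇔; _∘_; Equivalence)
open import Function.Definitions using (Injective)
open import Level using (Level)
open import Relation.Binary using (_Preserves_⟶_; Symmetric)
open import Relation.Binary.Construct.Closure.ReflexiveTransitive
  using (Star; ε; _◅_; _◅◅_; reverse)
open import Relation.Binary.PropositionalEquality using (_≡_; _≢_; refl; sym; trans; cong; cong₂;
  subst; subst₂; module ≡-Reasoning)
open import Relation.Nullary using (¬_; Dec; yes; no; does; contradiction)
open import Relation.Nullary.Decidable using (dec-true; _×-dec_; _⊎-dec_; ¬?)
open import Relation.Unary using (Pred; Decidable)

private variable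
  ℓ : Level
  n : ℕ

-- Finite subsets: comprehension, unions and cardinality.

comprehension : {P : Pred (Fin n) ℓ} → Decidable P → Subset n
comprehension P? = Vec.tabulate (does ∘ P?)

∈-comprehension⁺ : {P : Pred (Fin n) ℓ} (P? : Decidable P) {x : Fin n} →
                   P x → x ∈ comprehension P?
∈-comprehension⁺ P? {x} px =
  lookup⇒[]= x _ (trans (lookup∘tabulate (does ∘ P?) x) (dec-true (P? x) px))

∈-comprehension⁻ : {P : Pred (Fin n) ℓ} (P? : Decidable P) {x : Fin n} →
                   x ∈ comprehension P? → P x
∈-comprehension⁻ P? {x} x∈
  with P? x | trans (sym (lookup∘tabulate (does ∘ P?) x)) ([]=⇒lookup x∈)
... | yes px | _  = px
... | no  _  | ()

∈-⋃⁺ : {x : Fin n} {M : List (Subset n)} → Any (x ∈_) M → x ∈ ⋃ M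
∈-⋃⁺ (here x∈p)  = x∈p∪q⁺ (inj₁ x∈p)
∈-⋃⁺ (there x∈M) = x∈p∪q⁺ (inj₂ (∈-⋃⁺ x∈M))

∈-⋃⁻ : {x : Fin n} (M : List (Subset n)) → x ∈ ⋃ M → Any (x ∈_) M
∈-⋃⁻ []      x∈ = contradiction x∈ ∉⊥
∈-⋃⁻ (p ∷ M) x∈ with x∈p∪q⁻ p (⋃ M) x∈
... | inj₁ x∈p = here x∈p
... | inj₂ x∈M = there (∈-⋃⁻ M x∈M)

∣p∪q∣≡∣p∣+∣q∣ : (p q : Subset n) → Empty (p ∩ q) → ∣ p ∪ q ∣ ≡ ∣ p ∣ + ∣ q ∣
∣p∪q∣≡∣p∣+∣q∣ []            []            _ = refl
∣p∪q∣≡∣p∣+∣q∣ (inside  ∷ p) (inside  ∷ q) d = contradiction (zero , here) d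
∣p∪q∣≡∣p∣+∣q∣ (inside  ∷ p) (outside ∷ q) d = cong suc (∣p∪q∣≡∣p∣+∣q∣ p q (drop-∷-Empty d))
∣p∪q∣≡∣p∣+∣q∣ (outside ∷ p) (inside  ∷ q) d =
  trans (cong suc (∣p∪q∣≡∣p∣+∣q∣ p q (drop-∷-Empty d))) (sym (+-suc ∣ p ∣ ∣ q ∣))
∣p∪q∣≡∣p∣+∣q∣ (outside ∷ p) (outside ∷ q) d = ∣p∪q∣≡∣p∣+∣q∣ p q (drop-∷-Empty d)

∣p∣≤bound : (p : Subset n) (m : ℕ) → (∀ {x} → x ∈ p → toℕ x < m) → ∣ p ∣ ≤ m
∣p∣≤bound []            m       _ = z≤n
∣p∣≤bound (inside  ∷ p) zero    h = contradiction (h here) λ ()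
∣p∣≤bound (inside  ∷ p) (suc m) h = s≤s (∣p∣≤bound p m (≤-pred ∘ h ∘ there))
∣p∣≤bound (outside ∷ p) zero    h = ∣p∣≤bound p zero λ x∈p → contradiction (h (there x∈p)) λ ()
∣p∣≤bound (outside ∷ p) (suc m) h = m≤n⇒m≤1+n (∣p∣≤bound p m (≤-pred ∘ h ∘ there))

-- Matchings and components in an arbitrary graph.

module _ (G : Graph) where
  open Graph G using (Vertex; VertexSet; irrefl)

  ∣edge∣≡2 : {e : VertexSet} → IsEdge G e → ∣ e ∣ ≡ 2
  ∣edge∣≡2 (u , v , uv , refl) =
    trans (∣p∪q∣≡∣p∣+∣q∣ ⁅ u ⁆ ⁅ v ⁆ disjoint) (cong₂ _+_ (∣⁅x⁆∣≡1 u) (∣⁅x⁆∣≡1 v))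
    where
    disjoint : Empty (⁅ u ⁆ ∩ ⁅ v ⁆)
    disjoint (x , x∈) with x∈p∩q⁻ ⁅ u ⁆ ⁅ v ⁆ x∈
    ... | x∈u , x∈v = irrefl (trans (sym (x∈⁅y⁆⇒x≡y u x∈u)) (x∈⁅y⁆⇒x≡y v x∈v)) uv

  -- Disjointness makes the cardinalities of the two-element edges add up. The upper bound can then
  -- count covered vertices instead of edges.
  ∣V⟨M⟩∣≡2∣M∣ : (M : List VertexSet) → IsMatching G M → ∣ ⋃ M ∣ ≡ length M * 2
  ∣V⟨M⟩∣≡2∣M∣ M matching = go M (edges matching) (disjoint matching)
    where
    open IsMatching
    outside-edge : ∀ {e x} M → All (λ f → Empty (e ∩ f)) M → x ∈ e → ¬ Any (x ∈_) M
    outside-edge (f ∷ M) (d ∷ _)  x∈e (here x∈f)  = d (_ , x∈p∩q⁺ (x∈e , x∈f))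
    outside-edge (f ∷ M) (_ ∷ ds) x∈e (there x∈M) = outside-edge M ds x∈e x∈M

    go : ∀ M → All (IsEdge G) M → AllPairs (λ e f → Empty (e ∩ f)) M → ∣ ⋃ M ∣ ≡ length M * 2
    go []      _          _        = ∣⊥∣≡0 (Graph.order G)
    go (e ∷ M) (ee ∷ es) (d ∷ ds) =
      trans (∣p∪q∣≡∣p∣+∣q∣ e (⋃ M) e∩M) (cong₂ _+_ (∣edge∣≡2 ee) (go M es ds))
      where
      e∩M : Empty (e ∩ ⋃ M)
      e∩M (x , x∈) with x∈p∩q⁻ e (⋃ M) x∈
      ... | x∈e , x∈M = outside-edge M d x∈e (∈-⋃⁻ M x∈M)

  InducedAdj-sym : ∀ S → Symmetric (InducedAdj G S)
  InducedAdj-sym S (u∈ , v∈ , uv) = v∈ , u∈ , Graph.sym G uv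

  -- Closure under single steps extends to whole walks by induction, so a local check replaces the
  -- quantification over walks in `IsComponent`.
  component : ∀ {S C : VertexSet} (u : Vertex) → u ∈ S → u ∈ C →
              (∀ {v w} → v ∈ C → InducedAdj G S v w → w ∈ C) →
              (∀ {v} → v ∈ C → Star (InducedAdj G S) u v) →
              IsComponent G S C
  component {S} {C} u u∈S u∈C closed reachable = u , u∈S , λ v → mk⇔ reachable (walk u∈C)
    where
    walk : ∀ {v w} → v ∈ C → Star (InducedAdj G S) v w → w ∈ C
    walk v∈ ε        = v∈
    walk v∈ (a ◅ as) = walk (closed v∈ a) as

  root : ∀ {S C} → IsComponent G S C → Vertex
  root = proj₁

  root∈S : ∀ {S C} (c : IsComponent G S C) → root c ∈ S
  root∈S c = proj₁ (proj₂ c)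

  connected⇒⊆ : ∀ {S C D} (c : IsComponent G S C) (d : IsComponent G S D) →
                Star (InducedAdj G S) (root d) (root c) → C ⊆ D
  connected⇒⊆ (u , _ , c) (v , _ , d) v⟶u {x} x∈C =
    Equivalence.from (d x) (v⟶u ◅◅ Equivalence.to (c x) x∈C)

  connected⇒≡ : ∀ {S C D} (c : IsComponent G S C) (d : IsComponent G S D) →
                Star (InducedAdj G S) (root c) (root d) → C ≡ D
  connected⇒≡ {S} c d u⟶v =
    ⊆-antisym (connected⇒⊆ c d (reverse (InducedAdj-sym S) u⟶v)) (connected⇒⊆ d c u⟶v)

-- The graph of stacked pairs.

module Construction
  -- Indices are 0-based: `n` is k - 1 and `b i` is the (i+1)-st term of the sequence, so `n<bₙ` is
  -- the assumption that the last term is at least k.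
  (n : ℕ) (b : ℕ → ℕ)
  (antitone : ∀ {p q} → p ≤ q → b q ≤ b p)
  (n≤b : ∀ p → n ≤ b p) (n<bₙ : n < b n) (bₙ₊₁≡n : b (suc n) ≡ n)
  where

  Joined : ℕ → ℕ → Set
  Joined p q = p ≡ q ⊎ b (suc p) ≤ q ⊎ b (suc q) ≤ p

  Joined-sym : ∀ {p q} → Joined p q → Joined q p
  Joined-sym (inj₁ p≡q)        = inj₁ (sym p≡q)
  Joined-sym (inj₂ (inj₁ p⊲q)) = inj₂ (inj₂ p⊲q)
  Joined-sym (inj₂ (inj₂ q⊲p)) = inj₂ (inj₁ q⊲p)

  Joined? : ∀ p q → Dec (Joined p q)
  Joined? p q = p ≟ q ⊎-dec (b (suc p) ≤? q ⊎-dec b (suc q) ≤? p)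

  -- A vertex encodes a pair number and a side 0 or 1 by division with remainder by 2; `combine` is
  -- the inverse encoding.
  rank : Fin (b 0 * 2) → ℕ
  rank v = toℕ (quotient {b 0} 2 v)

  G : Graph
  G = record
    { order  = b 0 * 2
    ; Adj    = λ u v → u ≢ v × Joined (rank u) (rank v)
    ; adj?   = λ u v → ¬? (u Finₚ.≟ v) ×-dec Joined? (rank u) (rank v)
    ; sym    = λ (u≢v , uv) → u≢v ∘ sym , Joined-sym uv
    ; irrefl = λ u≡v (u≢v , _) → u≢v u≡v
    }

  open Graph G using (Vertex; VertexSet)

  rank-combine : ∀ p s → rank (combine p s) ≡ toℕ p
  rank-combine p s = cong (toℕ ∘ proj₁) (Finₚ.remQuot-combine {b 0} {2} p s)

  edge : Fin (b 0) → VertexSet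
  edge p = ⁅ combine p zero ⁆ ∪ ⁅ combine p (suc zero) ⁆

  edge-IsEdge : ∀ p → IsEdge G (edge p)
  edge-IsEdge p = combine p zero , combine p (suc zero) , (distinct , inj₁ ranks) , refl
    where
    distinct : combine p zero ≢ combine p (suc zero)
    distinct eq with Finₚ.combine-injectiveʳ {b 0} {2} p zero p (suc zero) eq
    ... | ()
    ranks = trans (rank-combine p zero) (sym (rank-combine p (suc zero)))

  combine∈edge : ∀ p s → combine p s ∈ edge p
  combine∈edge p zero       = x∈p∪q⁺ (inj₁ (x∈⁅x⁆ (combine p zero)))
  combine∈edge p (suc zero) = x∈p∪q⁺ (inj₂ (x∈⁅x⁆ (combine p (suc zero))))

  ∈-edge⁻ : ∀ p {v} → v ∈ edge p → rank v ≡ toℕ p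
  ∈-edge⁻ p v∈ with x∈p∪q⁻ ⁅ combine p zero ⁆ ⁅ combine p (suc zero) ⁆ v∈
  ... | inj₁ v∈₀ = trans (cong rank (x∈⁅y⁆⇒x≡y _ v∈₀)) (rank-combine p zero)
  ... | inj₂ v∈₁ = trans (cong rank (x∈⁅y⁆⇒x≡y _ v∈₁)) (rank-combine p (suc zero))

  ∈-edge⁺ : ∀ p {v} → rank v ≡ toℕ p → v ∈ edge p
  ∈-edge⁺ p {v} eq = subst (_∈ edge p)
    (trans (cong (λ q → combine q s) (sym (Finₚ.toℕ-injective {i = quotient {b 0} 2 v} eq)))
           (Finₚ.combine-remQuot {b 0} 2 v))
    (combine∈edge p s)
    where s = remainder {b 0} 2 v

  -- Lower bound: a matching of size `b i` with `suc i` components.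

  module _ (i : ℕ) (i≤n : i ≤ n) where
    pair : Fin (b i) → Fin (b 0)
    pair p = Fin.inject≤ p (antitone z≤n)

    toℕ-pair : ∀ p → toℕ (pair p) ≡ toℕ p
    toℕ-pair p = Finₚ.toℕ-inject≤ p (antitone z≤n)

    M : List VertexSet
    M = List.tabulate (edge ∘ pair)

    M-matching : IsMatching G M
    M-matching = record
      { edges    = Allₚ.tabulate⁺ (edge-IsEdge ∘ pair)
      ; disjoint = AllPairsₚ.tabulate⁺ disjoint
      }
      where
      disjoint : ∀ {p q} → p ≢ q → Empty (edge (pair p) ∩ edge (pair q))
      disjoint {p} {q} p≢q (v , v∈) with x∈p∩q⁻ (edge (pair p)) (edge (pair q)) v∈
      ... | v∈p , v∈q = p≢q (Finₚ.toℕ-injective (begin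
        toℕ p        ≡⟨ toℕ-pair p ⟨
        toℕ (pair p) ≡⟨ ∈-edge⁻ (pair p) v∈p ⟨
        rank v       ≡⟨ ∈-edge⁻ (pair q) v∈q ⟩
        toℕ (pair q) ≡⟨ toℕ-pair q ⟩
        toℕ q        ∎))
        where open ≡-Reasoning

    ∈-V⟨M⟩⁺ : ∀ {v} → rank v < b i → v ∈ ⋃ M
    ∈-V⟨M⟩⁺ {v} v<b = ∈-⋃⁺ (Anyₚ.tabulate⁺ p (∈-edge⁺ (pair p)
      (sym (trans (toℕ-pair p) (Finₚ.toℕ-fromℕ< v<b)))))
      where p = fromℕ< v<b

    ∈-V⟨M⟩⁻ : ∀ {v} → v ∈ ⋃ M → rank v < b i
    ∈-V⟨M⟩⁻ {v} v∈ with Anyₚ.tabulate⁻ (∈-⋃⁻ M v∈)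
    ... | p , v∈p = subst (_< b i) (sym (trans (∈-edge⁻ (pair p) v∈p) (toℕ-pair p))) (toℕ<n p)

    i<bᵢ : i < b i
    i<bᵢ = ≤-<-trans i≤n (<-≤-trans n<bₙ (antitone i≤n))

    -- The second condition says that `v` is joined to rank `b i - 1`, the largest rank in the
    -- matching. These vertices form the component of `apex`.
    Central : Vertex → Set
    Central v = rank v < b i × b (suc (rank v)) < b i

    Central? : Decidable Central
    Central? v = rank v <? b i ×-dec b (suc (rank v)) <? b i

    top : ℕ
    top = pred (b i)

    suc-top : suc top ≡ b i
    suc-top = suc-pred (b i) ⦃ >-nonZero (≤-<-trans z≤n i<bᵢ) ⦄

    vertex : ∀ {p} → .(p < b i) → Vertex
    vertex p<bᵢ = combine (pair (fromℕ< p<bᵢ)) zero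

    rank-vertex : ∀ {p} .(p<bᵢ : p < b i) → rank (vertex p<bᵢ) ≡ p
    rank-vertex p<bᵢ =
      trans (rank-combine (pair (fromℕ< p<bᵢ)) zero) (trans (toℕ-pair _) (Finₚ.toℕ-fromℕ< p<bᵢ))

    apex : Vertex
    apex = vertex (≤-reflexive suc-top)

    rank-apex : rank apex ≡ top
    rank-apex = rank-vertex (≤-reflexive suc-top)

    n≤top : n ≤ top
    n≤top = ≤-pred (subst (n <_) (sym suc-top) (<-≤-trans n<bₙ (antitone i≤n)))

    -- The extension value `b (suc n) ≡ n` acts here: it joins any two pairs of rank at least `n`,
    -- in particular `v` to the top pair.
    n≤⇒Central : ∀ {v} → n ≤ rank v → rank v < b i → Central v
    n≤⇒Central n≤v v<bᵢ = v<bᵢ , (begin-strict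
      b (suc (rank _)) ≤⟨ antitone (s≤s n≤v) ⟩
      b (suc n)        ≡⟨ bₙ₊₁≡n ⟩
      n                ≤⟨ n≤v ⟩
      rank _           <⟨ v<bᵢ ⟩
      b i              ∎)
      where open ≤-Reasoning

    Central-closed : ∀ {v w} → Central v → rank w < b i → Joined (rank v) (rank w) → Central w
    Central-closed (_ , tv<b) w<b (inj₁ v≡w)        = w<b , subst (λ p → b (suc p) < b i) v≡w tv<b
    -- Every value of `b` is at least `n`, so here `w` has rank at least `n`.
    Central-closed _          w<b (inj₂ (inj₁ v⊲w)) = n≤⇒Central (≤-trans (n≤b _) v⊲w) w<b
    Central-closed (v<b , _)  w<b (inj₂ (inj₂ w⊲v)) = w<b , ≤-<-trans w⊲v v<b

    apex-Central : Central apex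
    apex-Central = n≤⇒Central (subst (n ≤_) (sym rank-apex) n≤top)
      (subst (_< b i) (sym rank-apex) (≤-reflexive suc-top))

    apex⟶Central : ∀ {v} → Central v → Star (InducedAdj G (⋃ M)) apex v
    apex⟶Central {v} (v<b , tv<b) with apex Finₚ.≟ v
    ... | yes refl = ε
    ... | no apex≢v =
      (∈-V⟨M⟩⁺ (proj₁ apex-Central) , ∈-V⟨M⟩⁺ v<b , apex≢v , inj₂ (inj₂ v⊲apex)) ◅ ε
      where
      v⊲apex : b (suc (rank v)) ≤ rank apex
      v⊲apex = subst (b (suc (rank v)) ≤_) (sym rank-apex)
        (≤-pred (subst (b (suc (rank v)) <_) (sym suc-top) tv<b))

    -- A join from `p` upwards starts at rank `b (suc p)`, which is at least `b i` since
    -- `suc p ≤ i`, and so beyond the matching. A join from `q` to `p` would need `p` to be at least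
    -- `b (suc q)`, hence at least `n`, whereas `p < i ≤ n`.
    Joined-isolated : ∀ {p q} → p < i → q < b i → Joined p q → q ≡ p
    Joined-isolated p<i q<b (inj₁ p≡q)        = sym p≡q
    Joined-isolated p<i q<b (inj₂ (inj₁ p⊲q)) =
      contradiction (<-≤-trans q<b (≤-trans (antitone p<i) p⊲q)) (<-irrefl refl)
    Joined-isolated p<i q<b (inj₂ (inj₂ q⊲p)) =
      contradiction (≤-<-trans (≤-trans (n≤b _) q⊲p) (<-≤-trans p<i i≤n)) (<-irrefl refl)

    small : (p : Fin i) → toℕ p < b i
    small p = <-trans (toℕ<n p) i<bᵢ

    isolated : Fin i → Fin (b 0)
    isolated p = pair (fromℕ< (small p))

    toℕ-isolated : ∀ p → toℕ (isolated p) ≡ toℕ p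
    toℕ-isolated p = trans (toℕ-pair _) (Finₚ.toℕ-fromℕ< (small p))

    C : Fin (suc i) → VertexSet
    C zero    = comprehension Central?
    C (suc p) = edge (isolated p)

    rank-C-suc : ∀ p {v} → v ∈ C (suc p) → rank v ≡ toℕ p
    rank-C-suc p v∈ = trans (∈-edge⁻ (isolated p) v∈) (toℕ-isolated p)

    C-isComponent : ∀ j → IsComponent G (⋃ M) (C j)
    C-isComponent zero = component G apex
      (∈-V⟨M⟩⁺ (proj₁ apex-Central)) (∈-comprehension⁺ Central? apex-Central)
      (λ v∈ (_ , w∈M , _ , vw) → ∈-comprehension⁺ Central?
        (Central-closed (∈-comprehension⁻ Central? v∈) (∈-V⟨M⟩⁻ w∈M) vw))
      (apex⟶Central ∘ ∈-comprehension⁻ Central?)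
    C-isComponent (suc p) = component G u u∈M u∈C closed reachable
      where
      u   = vertex (small p)
      u∈C = combine∈edge (isolated p) zero
      u∈M = ∈-V⟨M⟩⁺ (subst (_< b i) (sym (rank-vertex (small p))) (small p))

      closed : ∀ {v w} → v ∈ C (suc p) → InducedAdj G (⋃ M) v w → w ∈ C (suc p)
      closed {v} {w} v∈ (_ , w∈M , _ , vw) = ∈-edge⁺ (isolated p) (trans
        (Joined-isolated (subst (_< i) (sym (rank-C-suc p v∈)) (toℕ<n p)) (∈-V⟨M⟩⁻ w∈M) vw)
        (∈-edge⁻ (isolated p) v∈))

      reachable : ∀ {v} → v ∈ C (suc p) → Star (InducedAdj G (⋃ M)) u v
      reachable {v} v∈ with u Finₚ.≟ v
      ... | yes refl = ε
      ... | no u≢v   = (u∈M , v∈M , u≢v , inj₁ u≡v) ◅ ε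
        where
        v∈M = ∈-V⟨M⟩⁺ (subst (_< b i) (sym (rank-C-suc p v∈)) (small p))
        u≡v = trans (rank-C-suc p u∈C) (sym (rank-C-suc p v∈))

    -- The apex tells them apart: its rank is at least `n`, while `C (suc p)` has only rank `toℕ p`,
    -- which is below `i`.
    C-zero≢C-suc : ∀ p → C zero ≢ C (suc p)
    C-zero≢C-suc p eq = <-irrefl
      (trans (sym (rank-C-suc p (subst (apex ∈_) eq (∈-comprehension⁺ Central? apex-Central))))
             rank-apex)
      (<-≤-trans (toℕ<n p) (≤-trans i≤n n≤top))

    C-injective : Injective _≡_ _≡_ C
    C-injective {zero}  {zero}  _  = refl
    C-injective {zero}  {suc q} eq = contradiction eq (C-zero≢C-suc q)
    C-injective {suc p} {zero}  eq = contradiction (sym eq) (C-zero≢C-suc p)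
    C-injective {suc p} {suc q} eq = cong suc (Finₚ.toℕ-injective (trans
      (sym (rank-C-suc p u∈C)) (rank-C-suc q (subst (vertex (small p) ∈_) eq u∈C))))
      where u∈C = combine∈edge (isolated p) zero

    attained : ∃ λ M → IsDisconnectedMatching G (suc i) M × length M ≡ b i
    attained = M , record
      { matching     = M-matching
      ; disconnected = inj₂ (C , C-injective , C-isComponent)
      } , length-tabulate (edge ∘ pair)

  -- Upper bound on disconnected matchings.

  few-components : ∀ {S w} j → w ∈ S → b (suc j) ≤ rank w → ¬ HasAtLeastComponents G S (suc (suc j))
  few-components {S} {w} j w∈S tj≤w (C , C-inj , comp) = clash (Finₚ.pigeonhole ≤-refl colour)
    where
    u : Fin (suc (suc j)) → Vertex
    u = root G ∘ comp

    -- Ranks are capped at `j`, leaving `suc j` colours for `suc (suc j)` roots; two roots of equal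
    -- colour will turn out to be connected.
    colour : Fin (suc (suc j)) → Fin (suc j)
    colour p = fromℕ< (s≤s (m⊓n≤n (rank (u p)) j))

    same-colour : ∀ p q → colour p ≡ colour q → rank (u p) ⊓ j ≡ rank (u q) ⊓ j
    same-colour p q = Finₚ.fromℕ<-injective _ _
      (s≤s (m⊓n≤n (rank (u p)) j)) (s≤s (m⊓n≤n (rank (u q)) j))

    adjacent : ∀ {v v′} → v ∈ S → v′ ∈ S → Joined (rank v) (rank v′) → Star (InducedAdj G S) v v′
    adjacent {v} {v′} v∈ v′∈ vv′ with v Finₚ.≟ v′
    ... | yes refl = ε
    ... | no v≢v′  = (v∈ , v′∈ , v≢v′ , vv′) ◅ ε

    ⟶w : ∀ p → j ≤ rank (u p) → Star (InducedAdj G S) (u p) w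
    -- Antitonicity gives `b (suc (rank (u p))) ≤ b (suc j) ≤ rank w`.
    ⟶w p j≤u = adjacent (root∈S G (comp p)) w∈S (inj₂ (inj₁ (≤-trans (antitone (s≤s j≤u)) tj≤w)))

    connect : ∀ p q → rank (u p) ⊓ j ≡ rank (u q) ⊓ j → Star (InducedAdj G S) (u p) (u q)
    connect p q eq with ≤-<-connex j (rank (u p)) | ≤-<-connex j (rank (u q))
    -- Both roots carry the capped colour `j` and are linked through `w`.
    ... | inj₁ j≤p | inj₁ j≤q = ⟶w p j≤p ◅◅ reverse (InducedAdj-sym G S) (⟶w q j≤q)
    ... | inj₁ j≤p | inj₂ q<j = contradiction
      (trans (sym (m≥n⇒m⊓n≡n j≤p)) (trans eq (m≤n⇒m⊓n≡m (<⇒≤ q<j)))) (>⇒≢ q<j)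
    ... | inj₂ p<j | inj₁ j≤q = contradiction
      (trans (sym (m≤n⇒m⊓n≡m (<⇒≤ p<j))) (trans eq (m≥n⇒m⊓n≡n j≤q))) (<⇒≢ p<j)
    -- Below the cap, equal colours are equal ranks, so both roots lie in the same pair.
    ... | inj₂ p<j | inj₂ q<j = adjacent (root∈S G (comp p)) (root∈S G (comp q)) (inj₁
      (trans (sym (m≤n⇒m⊓n≡m (<⇒≤ p<j))) (trans eq (m≤n⇒m⊓n≡m (<⇒≤ q<j)))))

    clash : ¬ ∃₂ λ p q → p Fin.< q × colour p ≡ colour q
    clash (p , q , p<q , same) =
      Finₚ.<⇒≢ p<q (C-inj (connected⇒≡ G (comp p) (comp q) (connect p q (same-colour p q same))))

  -- Vertices are numbered pair by pair, so a bound on ranks confines a vertex set to an initial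
  -- segment, whose length bounds its cardinality.
  rank<⇒toℕ< : ∀ {c} v → rank v < c → toℕ v < c * 2
  rank<⇒toℕ< {c} v v<c = begin-strict
    toℕ v                    ≡⟨ cong toℕ (Finₚ.combine-remQuot {b 0} 2 v) ⟨
    toℕ (combine q s)        ≡⟨ Finₚ.toℕ-combine q s ⟩
    2 * rank v + toℕ s       <⟨ +-monoʳ-< (2 * rank v) (toℕ<n s) ⟩
    2 * rank v + 2           ≡⟨ +-comm (2 * rank v) 2 ⟩
    2 + 2 * rank v           ≡⟨ *-suc 2 (rank v) ⟨
    2 * suc (rank v)         ≤⟨ *-monoʳ-≤ 2 v<c ⟩
    2 * c                    ≡⟨ *-comm 2 c ⟩
    c * 2                    ∎
    where
    open ≤-Reasoning
    q = quotient {b 0} 2 v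
    s = remainder {b 0} 2 v

  rank-bounded : ∀ i {S w} → w ∈ S → HasAtLeastComponents G S (suc i) → rank w < b i
  -- One component imposes no restriction: `G` has only `b 0` pairs.
  rank-bounded zero    {w = w} _   _     = toℕ<n (quotient {b 0} 2 w)
  rank-bounded (suc j)         w∈S comps = ≰⇒> λ b≤w → few-components j w∈S b≤w comps

  maximal : ∀ i M → IsDisconnectedMatching G (suc i) M → length M ≤ b i
  maximal i M dm with IsDisconnectedMatching.disconnected dm
  ... | inj₁ refl  = z≤n
  -- The `length M * 2` covered vertices all lie among the first `b i * 2`; cancel the 2.
  ... | inj₂ comps = *-cancelʳ-≤ (length M) (b i) 2 (subst (_≤ b i * 2)
    (∣V⟨M⟩∣≡2∣M∣ G M (IsDisconnectedMatching.matching dm))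
    (∣p∣≤bound (⋃ M) (b i * 2) λ {v} v∈ → rank<⇒toℕ< v (rank-bounded i v∈ comps)))

  ν : ∀ i → i ≤ n → DisconnectedMatchingNumber G (suc i) (b i)
  ν i i≤n = record { attained = attained i i≤n ; maximal = maximal i }

-- From integer sequences to the construction.

theorem28 : ∀ (n : ℕ) → let k = suc n in
    (β : Fin k → ℤ) →
    β Preserves Fin._≤_ ⟶ ℤ._≥_ →
    β (fromℕ n) ℤ.≥ + k →
    ∃ λ (G : Graph) → ∀ (i : Fin k) →
    ∃ λ (m : ℕ) → DisconnectedMatchingNumber G (suc (toℕ i)) m × β i ≡ + m
theorem28 n β β-antitone k≤βₖ = G , λ i →
  b (toℕ i) , ν (toℕ i) (≤-pred (toℕ<n i)) , β≡b i
  where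
  k≤β : ∀ i → + suc n ℤ.≤ β i
  k≤β i = ℤₚ.≤-trans k≤βₖ (β-antitone (Finₚ.≤fromℕ i))

  +∣β∣≡β : ∀ i → + ℤ.∣ β i ∣ ≡ β i
  -- All terms are at least k, hence nonnegative, so absolute values lose nothing.
  +∣β∣≡β i = ℤₚ.0≤i⇒+∣i∣≡i (ℤₚ.≤-trans (ℤ.+≤+ z≤n) (k≤β i))

  k≤∣β∣ : ∀ i → suc n ≤ ℤ.∣ β i ∣
  k≤∣β∣ i = ℤₚ.drop‿+≤+ (subst (_ ℤ.≤_) (sym (+∣β∣≡β i)) (k≤β i))

  ∣β∣-antitone : ∀ {i j} → i Fin.≤ j → ℤ.∣ β j ∣ ≤ ℤ.∣ β i ∣
  ∣β∣-antitone {i} {j} i≤j = ℤₚ.drop‿+≤+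
    (subst₂ ℤ._≤_ (sym (+∣β∣≡β j)) (sym (+∣β∣≡β i)) (β-antitone i≤j))

  b : ℕ → ℕ
  b p with p <? suc n
  ... | yes p<k = ℤ.∣ β (fromℕ< p<k) ∣
  -- The default k - 1 lies below every term, which keeps `b` antitone, and makes all pairs of rank
  -- at least `n` joined to one another.
  ... | no  _   = n

  b-antitone : ∀ {p q} → p ≤ q → b q ≤ b p
  b-antitone {p} {q} p≤q with p <? suc n | q <? suc n
  ... | yes p<k | yes q<k = ∣β∣-antitone
    (subst₂ _≤_ (sym (Finₚ.toℕ-fromℕ< p<k)) (sym (Finₚ.toℕ-fromℕ< q<k)) p≤q)
  ... | yes p<k | no  _   = <⇒≤ (k≤∣β∣ (fromℕ< p<k))
  ... | no  p≮k | yes q<k = contradiction (≤-<-trans p≤q q<k) p≮k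
  ... | no  _   | no  _   = ≤-refl

  n≤b : ∀ p → n ≤ b p
  n≤b p with p <? suc n
  ... | yes p<k = <⇒≤ (k≤∣β∣ (fromℕ< p<k))
  ... | no  _   = ≤-refl

  n<bₙ : n < b n
  n<bₙ with n <? suc n
  ... | yes n<k = k≤∣β∣ (fromℕ< n<k)
  ... | no  n≮k = contradiction ≤-refl n≮k

  bₙ₊₁≡n : b (suc n) ≡ n
  bₙ₊₁≡n with suc n <? suc n
  ... | yes k<k = contradiction k<k (<-irrefl refl)
  ... | no  _   = refl

  β≡b : ∀ i → β i ≡ + b (toℕ i)
  β≡b i with toℕ i <? suc n
  ... | yes i<k = trans (sym (+∣β∣≡β i))
    (cong (+_ ∘ ℤ.∣_∣ ∘ β) (sym (Finₚ.fromℕ<-toℕ i i<k)))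
  ... | no  i≮k = contradiction (toℕ<n i) i≮k

  open Construction n b b-antitone n≤b n<bₙ bₙ₊₁≡n
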